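{- For every propositional formula $\phi$ (i.e. built from atoms in $AP$ using only $\neg$ and $\land$) and every $A\subseteq Ag$, the formulas $$[\phi]^-_A E_A\phi \qquad\text{and}\qquad [\phi]^+_A C_A\phi$$ are valid, i.e. satisfied at every world of every Kripke model.
   Context: Language. $AP$ is a set of atoms and $Ag$ a finite set of agents. The formulas of $\mathcal{L}_{glal}$ are given, for $p\in AP$ and $A\subseteq Ag$, by $\psi ::= p \mid \neg\psi \mid \psi\land\psi \mid C_A\psi \mid [\psi]^+_A\psi \mid [\psi]^-_A\psi$. Abbreviations: $K_a\psi := C_{\{a\}}\psi$ and $E_A\psi := \bigwedge_{a\in A}K_a\psi$. Models. A (Kripke) model is $\mathcal{M}=\langle W,\{R_a\}_{a\in Ag},V\rangle$ with $W$ a set of worlds, each $R_a$ an equivalence relation on $W$, and $V:AP\to 2^W$. For $w\in W$, $R_a(w)=\{w' : R_a(w,w')\}$; for $A\subseteq Ag$, $R^C_A=(\bigcup_{a\in A}R_a)^*$ is the reflexive-transitive closure and $R^C_A(w)=\{w' : R^C_A(w,w')\}$. Semantics. The satisfaction set $[\![\varphi]\!]_{\mathcal{M}}\subseteq W$ is defined by: $[\![p]\!]_{\mathcal{M}}=V(p)$; $[\![\neg\psi]\!]_{\mathcal{M}}=W\setminus[\![\psi]\!]_{\mathcal{M}}$; $[\![\psi\land\psi']\!]_{\mathcal{M}}=[\![\psi]\!]_{\mathcal{M}}\cap[\![\psi']\!]_{\mathcal{M}}$; $[\![C_A\psi]\!]_{\mathcal{M}}=\{w : R^C_A(w)\subseteq[\![\psi]\!]_{\mathcal{M}}\}$;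 and for $\star\in\{+,-\}$, $[\![[\psi]^\star_A\psi']\!]_{\mathcal{M}}=\{w : \text{if } w\in[\![\psi]\!]_{\mathcal{M}} \text{ then } w\in[\![\psi']\!]_{\mathcal{M}^\star_{(w,\psi,A)}}\}$. The refinements $\mathcal{M}^-_{(w,\psi,A)}$ and $\mathcal{M}^+_{(w,\psi,A)}$ have the same worlds and valuation as $\mathcal{M}$ and relations $R^-_b=R^+_b=R_b$ for $b\notin A$, while for $a\in A$: $R^-_a(v)=R_a(v)\cap[\![\psi]\!]_{\mathcal{M}}$ if $v\in R_a(w)\cap[\![\psi]\!]_{\mathcal{M}}$; $R^-_a(v)=R_a(v)\cap[\![\neg\psi]\!]_{\mathcal{M}}$ if $v\in R_a(w)\cap[\![\neg\psi]\!]_{\mathcal{M}}$; $R^-_a(v)=R_a(v)$ otherwise; and $R^+_a(v)$ is defined by the same three cases with $R_a(w)$ replaced by $R^C_A(w)$ in the case conditions. A formula $\varphi$ is satisfied at $w$ in $\mathcal{M}$, $(\mathcal{M},w)\models\varphi$, if $w\in[\![\varphi]\!]_{\mathcal{M}}$. -}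

module Defs where

open import Level using (Level; suc; _⊔_)
open import Axiom.ExcludedMiddle using (ExcludedMiddle)
open import Data.Nat.Base using (ℕ)
open import Data.Fin.Base using (Fin)
open import Data.Fin.Subset using (Subset; ⁅_⁆; _∈_)
open import Data.Fin.Subset.Properties using (_∈?_)
open import Data.List.Base using (List; []; _∷_; map; filter; allFin)
open import Data.Product.Base using (∃; _×_; _,_; proj₁; proj₂)
open import Relation.Binary.Core using (Rel)
open import Relation.Binary.Structures using (IsEquivalence)
open import Relation.Binary.Construct.Closure.ReflexiveTransitive
  using (Star; ε; _◅_; _◅◅_)
open import Relation.Nullary using (¬_; yes; no; contradiction)
open import Relation.Unary using (Pred; _∩_; ∁; _⊆_) renaming (_∈_ to _∈ₚ_)

infix  8 ¬ᶠ_
infixr 7 _∧ᶠ_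
infix  8 [_]⁺[_]_ [_]⁻[_]_

data Formula {a} (AP : Set a) (n : ℕ) : Set a where
  atom      : AP → Formula AP n
  ¬ᶠ_       : Formula AP n → Formula AP n
  _∧ᶠ_      : Formula AP n → Formula AP n → Formula AP n
  C         : Subset n → Formula AP n → Formula AP n
  [_]⁺[_]_  : Formula AP n → Subset n → Formula AP n → Formula AP n
  [_]⁻[_]_  : Formula AP n → Subset n → Formula AP n → Formula AP n

data Propositional {a} {AP : Set a} {n} : Formula AP n → Set a where
  atom : ∀ p → Propositional (atom p)
  ¬ᶠ_  : ∀ {φ} → Propositional φ → Propositional (¬ᶠ φ)
  _∧ᶠ_ : ∀ {φ ψ} → Propositional φ → Propositional ψ → Propositional (φ ∧ᶠ ψ)

module _ {a} {AP : Set a} {n : ℕ} where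

  K : Fin n → Formula AP n → Formula AP n
  K a = C ⁅ a ⁆

  -- The language has no constant for truth, so the empty conjunction is the
  -- tautology ¬(ψ ∧ ¬ψ) over a supplied formula ψ.
  ⋀ : Formula AP n → List (Formula AP n) → Formula AP n
  ⋀ ψ []            = ¬ᶠ (ψ ∧ᶠ ¬ᶠ ψ)
  ⋀ ψ (χ ∷ [])      = χ
  ⋀ ψ (χ ∷ χ′ ∷ χs) = χ ∧ᶠ ⋀ ψ (χ′ ∷ χs)

  E : Subset n → Formula AP n → Formula AP n
  E A ψ = ⋀ ψ (map (λ a → K a ψ) (filter (_∈? A) (allFin n)))

-- Models without the requirement that the relations be equivalences.  The
-- semantic clauses never use that requirement, and the refinements below
-- preserve it only classically (see refine⁻-equivalence, refine⁺-equivalence).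
record Structure {a} (AP : Set a) (n : ℕ) (ℓ : Level) : Set (a ⊔ suc ℓ) where
  field
    W : Set ℓ
    R : Fin n → Rel W ℓ
    V : AP → Pred W ℓ

  Rᶜ : Subset n → Rel W ℓ
  Rᶜ A = Star (λ v u → ∃ λ a → a ∈ A × R a v u)

record Model {a} (AP : Set a) (n : ℕ) (ℓ : Level) : Set (a ⊔ suc ℓ) where
  field
    structure     : Structure AP n ℓ
    isEquivalence : ∀ a → IsEquivalence (Structure.R structure a)

  open Structure structure public

-- Here S is the satisfaction set of the announced formula and D is the region,
-- R_a(w) or R^C_A(w), occurring in the case conditions.  Membership of u in the
-- set defined by the three cases is expressed by one implication per case.
ByCases : ∀ {ℓ} {W : Set ℓ} → Rel W ℓ → Pred W ℓ → Pred W ℓ → Rel W ℓ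
ByCases R S D v u =
    (v ∈ₚ D ∩ S → u ∈ₚ R v ∩ S)
  × (v ∈ₚ D ∩ ∁ S → u ∈ₚ R v ∩ ∁ S)
  × (¬ (v ∈ₚ D ∩ S) → ¬ (v ∈ₚ D ∩ ∁ S) → u ∈ₚ R v)

module _ {a} {AP : Set a} {n : ℕ} {ℓ : Level} where

  refinedR : (M : Structure AP n ℓ) → let open Structure M in
             Subset n → Pred W ℓ → (Fin n → Pred W ℓ) → Fin n → Rel W ℓ
  refinedR M A S D b with b ∈? A
  ... | yes _ = ByCases (Structure.R M b) S (D b)
  ... | no  _ = Structure.R M b

  refine⁻ refine⁺ : (M : Structure AP n ℓ) → let open Structure M in
                    W → Pred W ℓ → Subset n → Structure AP n ℓ
  refine⁻ M w S A = record
    { W = W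
    ; R = refinedR M A S (λ a → R a w)
    ; V = V
    } where open Structure M
  refine⁺ M w S A = record
    { W = W
    ; R = refinedR M A S (λ _ → Rᶜ A w)
    ; V = V
    } where open Structure M

  ⟦_⟧ : Formula AP n → (M : Structure AP n ℓ) → Pred (Structure.W M) ℓ
  ⟦ atom p ⟧         M   = Structure.V M p
  ⟦ ¬ᶠ ψ ⟧           M   = ∁ (⟦ ψ ⟧ M)
  ⟦ ψ ∧ᶠ ψ′ ⟧        M   = ⟦ ψ ⟧ M ∩ ⟦ ψ′ ⟧ M
  ⟦ C A ψ ⟧          M w = Structure.Rᶜ M A w ⊆ ⟦ ψ ⟧ M
  ⟦ [ ψ ]⁺[ A ] ψ′ ⟧ M w = w ∈ₚ ⟦ ψ ⟧ M → w ∈ₚ ⟦ ψ′ ⟧ (refine⁺ M w (⟦ ψ ⟧ M) A)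
  ⟦ [ ψ ]⁻[ A ] ψ′ ⟧ M w = w ∈ₚ ⟦ ψ ⟧ M → w ∈ₚ ⟦ ψ′ ⟧ (refine⁻ M w (⟦ ψ ⟧ M) A)

  infix 4 _,_⊨_

  _,_⊨_ : (M : Model AP n ℓ) → Model.W M → Formula AP n → Set ℓ
  M , w ⊨ φ = w ∈ₚ ⟦ φ ⟧ (Model.structure M)

Valid : ∀ {a} {AP : Set a} {n} (ℓ : Level) → Formula AP n → Set (a ⊔ suc ℓ)
Valid {AP = AP} {n} ℓ φ = (M : Model AP n ℓ) (w : Model.W M) → M , w ⊨ φ

module _ {ℓ} (em : ExcludedMiddle ℓ) where

  byCases-equivalence : {W : Set ℓ} {R : Rel W ℓ} (S D : Pred W ℓ) →
                        IsEquivalence R → (∀ {v u} → R v u → D v → D u) →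
                        IsEquivalence (ByCases R S D)
  byCases-equivalence {W} {R} S D eq closed = record
    { refl  = (λ (_ , s) → ≈.refl , s) , (λ (_ , s) → ≈.refl , s) , λ _ _ → ≈.refl
    ; sym   = λ r → let vu = sound r in
        intro (≈.sym vu)
          (λ d s → proj₂ (same r (closed (≈.sym vu) d)) s)
          (λ d s t → s (proj₁ (same r (closed (≈.sym vu) d)) t))
    ; trans = λ r r′ → let vu = sound r in
        intro (≈.trans vu (sound r′))
          (λ d s → proj₁ (same r′ (closed vu d)) (proj₁ (same r d) s))
          (λ d s t → s (proj₂ (same r d) (proj₂ (same r′ (closed vu d)) t)))
    }
    where
    module ≈ = IsEquivalence eq

    sound : ∀ {v u} → ByCases R S D v u → R v u
    sound {v} (f , g , h) with em {v ∈ₚ D ∩ S} | em {v ∈ₚ D ∩ ∁ S}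
    ... | yes p | _     = proj₁ (f p)
    ... | no _  | yes q = proj₁ (g q)
    ... | no p  | no q  = h p q

    same : ∀ {v u} → ByCases R S D v u → D v → (S v → S u) × (S u → S v)
    same {v} (f , g , _) d with em {S v}
    ... | yes s = (λ _ → proj₂ (f (d , s))) , λ _ → s
    ... | no ¬s = (λ s → contradiction s ¬s) ,
                  (λ t → contradiction t (proj₂ (g (d , ¬s))))

    intro : ∀ {v u} → R v u → (D v → S v → S u) → (D v → ¬ S v → ¬ S u) →
            ByCases R S D v u
    intro r f g = (λ (d , s) → r , f d s) , (λ (d , s) → r , g d s) , λ _ _ → r

  module _ {a} {AP : Set a} {n} (M : Model AP n ℓ) (w : Model.W M)
           (S : Pred (Model.W M) ℓ) (A : Subset n) where

    open Model M

    refine⁻-equivalence : ∀ b → IsEquivalence (Structure.R (refine⁻ structure w S A) b)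
    refine⁻-equivalence b with b ∈? A
    ... | yes _ = byCases-equivalence S (R b w) (isEquivalence b)
                    (λ vu wv → IsEquivalence.trans (isEquivalence b) wv vu)
    ... | no  _ = isEquivalence b

    refine⁺-equivalence : ∀ b → IsEquivalence (Structure.R (refine⁺ structure w S A) b)
    refine⁺-equivalence b with b ∈? A
    ... | yes b∈A = byCases-equivalence S (Rᶜ A w) (isEquivalence b)
                      (λ vu wv → wv ◅◅ ((b , b∈A , vu) ◅ ε))
    ... | no  _   = isEquivalence b

{-# OPTIONS --safe #-}
-- Once the true announcement φ has removed every link of an agent of A from a
-- φ-world of the region D to a ¬φ-world, no path of such links starting at w
-- can leave D ∩ ⟦φ⟧: the region is itself closed under the original relations.
-- As φ is propositional, its truth at the end of the path is unaffected by the
-- refinement.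
module Submission where

open import Data.Fin.Subset using (Subset; ⁅_⁆; _∈_)
open import Data.Fin.Subset.Properties using (_∈?_; x∈⁅y⁆⇒x≡y)
open import Data.Fin.Base using (Fin)
open import Data.List.Base using (allFin)
open import Data.List.Relation.Unary.All as All using (All; []; _∷_)
open import Data.List.Relation.Unary.All.Properties using (map⁺; all-filter)
open import Data.Nat.Base using (ℕ)
open import Data.Product.Base using (_×_; _,_)
open import Level using (Level)
open import Relation.Binary.Construct.Closure.ReflexiveTransitive using (ε; _◅_; _◅◅_)
open import Relation.Binary.Core using (Rel)
open import Relation.Binary.PropositionalEquality using (_≡_; refl; cong; cong₂; subst)
open import Relation.Binary.Structures using (IsEquivalence)
open import Relation.Nullary using (yes; no; contradiction)
open import Relation.Unary using (Pred; _∩_; ∁; _⊆_) renaming (_∈_ to _∈ₚ_)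
open import Defs

module _ {a ℓ : Level} {AP : Set a} {n : ℕ} where

  -- The clauses for atoms, negation and conjunction consult only `W` and `V`. Atoms agree
  -- definitionally, so congruence yields equality of the predicates themselves.
  ⟦⟧-propositional : {φ : Formula AP n} → Propositional φ →
    {W : Set ℓ} {R R′ : Fin n → Rel W ℓ} {V : AP → Pred W ℓ} →
    ⟦ φ ⟧ (record { W = W ; R = R ; V = V }) ≡ ⟦ φ ⟧ (record { W = W ; R = R′ ; V = V })
  ⟦⟧-propositional (atom p) = refl
  ⟦⟧-propositional (¬ᶠ φ)   = cong ∁ (⟦⟧-propositional φ)
  ⟦⟧-propositional (φ ∧ᶠ ψ) = cong₂ _∩_ (⟦⟧-propositional φ) (⟦⟧-propositional ψ)

  ⋀-intro : (M : Structure AP n ℓ) {w : Structure.W M} {ψ : Formula AP n} → ∀ {χs} →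
    All (λ χ → w ∈ₚ ⟦ χ ⟧ M) χs → w ∈ₚ ⟦ ⋀ ψ χs ⟧ M
  ⋀-intro M []            = λ (s , ¬s) → ¬s s
  ⋀-intro M (s ∷ [])      = s
  ⋀-intro M (s ∷ s′ ∷ ss) = s , ⋀-intro M (s′ ∷ ss)

  E-intro : (M : Structure AP n ℓ) {w : Structure.W M} {ψ : Formula AP n} (A : Subset n) →
    (∀ {b} → b ∈ A → w ∈ₚ ⟦ K b ψ ⟧ M) → w ∈ₚ ⟦ E A ψ ⟧ M
  E-intro M A k = ⋀-intro M (map⁺ (All.map k (all-filter (_∈? A) (allFin n))))

  module _ (M : Structure AP n ℓ) {A : Subset n} {S : Pred (Structure.W M) ℓ}
           {D : Fin n → Pred (Structure.W M) ℓ} where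

    open Structure M

    -- The assumption on `v` selects the first case of `ByCases`, with no need to decide `S`.
    refinedR-step : ∀ {b} → b ∈ A → ∀ {v u} → v ∈ₚ D b ∩ S →
      refinedR M A S D b v u → u ∈ₚ R b v ∩ S
    refinedR-step {b} b∈A v∈ r with b ∈? A
    ... | yes _  = let (f , _) = r in f v∈
    ... | no b∉A = contradiction b∈A b∉A

    -- Induction on the path with invariant `P ∩ S`. Keeping the agents `B` of the path apart from
    -- the refined agents `A` lets this serve both `K a`, with `B` a singleton, and `C A`.
    refinedR-invariant : (B : Subset n) (P : Pred W ℓ) →
      (∀ {b} → b ∈ B → b ∈ A × P ⊆ D b × (∀ {v u} → P v → R b v u → P u)) →
      ∀ {v} → v ∈ₚ P ∩ S →
      Structure.Rᶜ (record { W = W ; R = refinedR M A S D ; V = V }) B v ⊆ S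
    refinedR-invariant B P closed (_ , s) ε = s
    refinedR-invariant B P closed (p , s) ((b , b∈B , r) ◅ rs) =
      let (b∈A , P⊆D , step) = closed b∈B
          (vu , t)           = refinedR-step b∈A (P⊆D p , s) r
      in refinedR-invariant B P closed (step p vu , t) rs

proposition4 : ∀ {a ℓ : Level} {AP : Set a} {n : ℕ} (φ : Formula AP n) → Propositional φ → (A : Subset n) →
    Valid ℓ ([ φ ]⁻[ A ] E A φ) × Valid ℓ ([ φ ]⁺[ A ] C A φ)
proposition4 {ℓ = ℓ} {n = n} φ prop A = valid⁻ , valid⁺
  where
  valid⁻ : Valid ℓ ([ φ ]⁻[ A ] E A φ)
  valid⁻ M w s = E-intro (refine⁻ structure w (⟦ φ ⟧ structure) A) A λ {a} a∈A path →
    -- The invariant gives truth of `φ` in the original model; the goal asks for it in the refined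
    -- one.
    subst (_ ∈ₚ_) (⟦⟧-propositional prop)
      (refinedR-invariant structure ⁅ a ⁆ (R a w) (closed a∈A)
        (IsEquivalence.refl (isEquivalence a) , s) path)
    where
    open Model M

    -- A path for `K a` may have many links, all of agent `a`; transitivity of `R a` keeps its
    -- worlds in `R a w`.
    closed : ∀ {a} → a ∈ A → ∀ {b} → b ∈ ⁅ a ⁆ →
      b ∈ A × R a w ⊆ R b w × (∀ {v u} → R a w v → R b v u → R a w u)
    closed {a} a∈A b∈⁅a⁆ with refl ← x∈⁅y⁆⇒x≡y a b∈⁅a⁆ =
      a∈A , (λ r → r) , IsEquivalence.trans (isEquivalence a)

  valid⁺ : Valid ℓ ([ φ ]⁺[ A ] C A φ)
  valid⁺ M w s path = subst (_ ∈ₚ_) (⟦⟧-propositional prop)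
    (refinedR-invariant structure A (Rᶜ A w)
      -- Appending a link of an agent of `A` to a path from `w` extends the path.
      (λ {b} b∈A → b∈A , (λ r → r) , λ wv vu → wv ◅◅ ((b , b∈A , vu) ◅ ε))
      (ε , s) path)
    where open Model M
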